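{- There exists a function $f:\mathbb{N}^2\to\mathbb{N}$ such that, for all positive integers $s$ and $t$, if $M$ is a matroid with the $(s,2s,t,2t)$-property and $|E(M)|\ge f(s,t)$, then $M$ is an $(s,t)$-spike.
   Context: For integers $u\ge s\ge 1$ and $v\ge t\ge 1$, a matroid $M$ has the $(s,u,t,v)$-property if every $s$-element subset of $E(M)$ is contained in a circuit of $M$ of size $u$, and every $t$-element subset of $E(M)$ is contained in a cocircuit of $M$ of size $v$. For positive integers $s,t$, an $(s,t)$-spike is a matroid $M$ for which there exist an integer $m\ge\max\{s,t\}$ and a partition $(A_1,\dots,A_m)$ of $E(M)$ into $2$-element sets such that for every $s$-element set $I\subseteq\{1,\dots,m\}$ the set $\bigcup_{i\in I}A_i$ is a circuit of $M$, and for every $t$-element set $J\subseteq\{1,\dots,m\}$ the set $\bigcup_{j\in J}A_j$ is a cocircuit of $M$. -}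

module Defs where

open import Data.Nat using (ℕ; _<_; _≤_; _⊔_)
open import Data.Fin using (Fin)
open import Data.Fin.Subset
  using (Subset; ⊥; ⁅_⁆; _∈_; _∉_; _⊆_; _⊂_; _∪_; _∩_; ∣_∣; Nonempty)
open import Data.Vec using (tabulate; lookup)
open import Data.Product using (Σ; ∃; _×_)
open import Relation.Nullary using (¬_)
open import Relation.Unary using (Decidable)
open import Relation.Binary.PropositionalEquality using (_≡_)

record Matroid (n : ℕ) : Set₁ where
  field
    Indep   : Subset n → Set
    Indep?  : Decidable Indep
    I1      : Indep ⊥
    I2      : ∀ {X Y} → Y ⊆ X → Indep X → Indep Y
    I3      : ∀ {X Y} → Indep X → Indep Y → ∣ X ∣ < ∣ Y ∣ →
              ∃ λ y → y ∈ Y × y ∉ X × Indep (X ∪ ⁅ y ⁆)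

module _ {n : ℕ} (M : Matroid n) where
  open Matroid M

  IsCircuit : Subset n → Set
  IsCircuit C = ¬ Indep C × (∀ D → D ⊂ C → Indep D)

  IsBasis : Subset n → Set
  IsBasis B = Indep B × (∀ X → Indep X → B ⊆ X → X ≡ B)

  -- a set is dependent in the dual M* iff it is not contained in the
  -- complement of a basis, i.e. it meets every basis of M
  DualDependent : Subset n → Set
  DualDependent X = ∀ B → IsBasis B → Nonempty (X ∩ B)

  IsCocircuit : Subset n → Set
  IsCocircuit C = DualDependent C × (∀ D → D ⊂ C → ¬ DualDependent D)

  HasProperty : ℕ → ℕ → ℕ → ℕ → Set
  HasProperty s u t v =
    (s ≤ u) × (t ≤ v) ×
    (∀ X → ∣ X ∣ ≡ s → ∃ λ C → X ⊆ C × IsCircuit C × ∣ C ∣ ≡ u) ×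
    (∀ X → ∣ X ∣ ≡ t → ∃ λ C → X ⊆ C × IsCocircuit C × ∣ C ∣ ≡ v)

-- union of the blocks A_i (i ∈ I) of the partition given by p : E → Fin m
-- (A_i = p⁻¹(i))
blocks : {n m : ℕ} → (Fin n → Fin m) → Subset m → Subset n
blocks p I = tabulate (λ e → lookup I (p e))

IsSpike : {n : ℕ} → Matroid n → ℕ → ℕ → Set
IsSpike {n} M s t =
  Σ ℕ λ m → (s ⊔ t ≤ m) × Σ (Fin n → Fin m) λ p →
    (∀ i → ∣ blocks p ⁅ i ⁆ ∣ ≡ 2) ×
    (∀ I → ∣ I ∣ ≡ s → IsCircuit M (blocks p I)) ×
    (∀ J → ∣ J ∣ ≡ t → IsCocircuit M (blocks p J))

{-# OPTIONS --safe #-}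

-- A set of nullity greater than |W| stays dependent after deleting W, so a large M has a circuit of bounded size
-- off any bounded set, hence arbitrarily many disjoint circuits. Take N of these, with a root y in each, and many
-- groups of t - 1 others. By orthogonality, a 2t-element cocircuit through y and one element of each circuit of a
-- group has exactly two elements in each of these t circuits: besides y it has one element z in the circuit of y and
-- is otherwise inside the group. A fixed 2s-element circuit through y misses most groups and so contains their z,
-- whence some z arises from more than 2s groups; then every 2s-element circuit contains both or neither of y and z.
-- With many disjoint pairs tied in this way, a 2s-element circuit through e and s - 1 pairs is those pairs together
-- with e and one more element, and orthogonality transfers ties between circuits and cocircuits and shows that this
-- element is tied to e. It is unique, so E(M) is partitioned into tied pairs. A 2s-element circuit through
-- representatives of s pairs must then be the union of these pairs, and dually.
module Submission where

open import Defs
open import Data.Nat using (ℕ; zero; suc; _+_; _*_; _⊔_; _≤_; _<_; z≤n; s≤s; _≤?_; pred)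
open import Data.Nat.Properties hiding (_≟_; _<?_; <-cmp; <-asym)
open import Data.Nat.Solver using (module +-*-Solver)
open import Data.Fin using (Fin; zero; suc) renaming (_<_ to _<ᶠ_)
open import Data.Fin.Properties using (_≟_; _<?_; <-cmp; <-asym; any?)
open import Data.Fin.Subset using (Subset; inside; outside; ⊥; ⊤; ⁅_⁆; _∈_; _∉_; _⊆_; _⊂_; _∪_; _∩_; _─_; _-_; ∣_∣; Nonempty)
open import Data.Fin.Subset.Properties hiding (⊆-refl; ⊆-trans)
open import Data.Vec using ([]; _∷_; here; there)
open import Data.Vec.Properties using (lookup⇒[]=; []=⇒lookup; lookup∘tabulate)
open import Data.List using (List; []; _∷_; _++_; length; map; filter; concatMap; allFin; take; lookup)
open import Data.List.Properties using (length-++; length-map; length-take)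
open import Data.List.Relation.Unary.All as All using (All; []; _∷_)
open import Data.List.Relation.Unary.All.Properties using (¬Any⇒All¬; all-filter; concat⁺) renaming (++⁺ to All-++⁺; map⁺ to All-map⁺; map⁻ to All-map⁻)
open import Data.List.Relation.Unary.Any as Any using (here; there)
open import Data.List.Relation.Unary.Any.Properties using (lookup-index)
open import Data.List.Relation.Unary.AllPairs as AllPairs using (AllPairs; []; _∷_)
open import Data.List.Relation.Unary.AllPairs.Properties using () renaming (map⁺ to AllPairs-map⁺)
open import Data.List.Relation.Unary.Unique.Propositional using (Unique)
open import Data.List.Relation.Unary.Unique.Propositional.Properties using (allFin⁺; filter⁺; ++⁺; map⁺) renaming (concat⁺ to unique-concat⁺)
open import Data.List.Relation.Binary.Disjoint.Propositional using (Disjoint)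
open import Data.List.Relation.Binary.Sublist.Propositional using ([]; _∷_; _∷ʳ_) renaming (_⊆_ to _⊑_; ⊆-refl to ⊑-refl; ⊆-trans to ⊑-trans)
open import Data.List.Relation.Binary.Sublist.Propositional.Properties using (All-resp-⊆; take-⊆)
open import Data.List.Membership.Propositional using (find) renaming (_∈_ to _∈ₗ_; _∉_ to _∉ₗ_)
open import Data.List.Membership.Propositional.Properties using (∈-filter⁺; ∈-filter⁻; ∈-allFin; ∈-++⁺ˡ; ∈-++⁺ʳ; ∈-++⁻; ∈-map⁺; ∈-map⁻; ∈-lookup; ∈-concatMap⁻)
open import Data.Product using (Σ; ∃; _×_; _,_; proj₁; proj₂)
open import Data.Sum using (_⊎_; inj₁; inj₂; [_,_]′)
open import Function using (_∘_; _on_)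
open import Relation.Nullary using (¬_; yes; no; contradiction)
open import Relation.Nullary.Decidable using (_×-dec_; ¬?; decidable-stable)
open import Relation.Binary using (tri<; tri≈; tri>)
open import Relation.Binary.PropositionalEquality

module _ {n : ℕ} where
  open import Data.List.Membership.DecPropositional (_≟_ {n}) public using () renaming (_∈?_ to _∈ₗ?_)

-- Cardinalities of subsets, counted by lists

x∈p─q⇒x∉q : ∀ {n} (p q : Subset n) {x} → x ∈ p ─ q → x ∉ q
x∈p─q⇒x∉q (_ ∷ p) (inside ∷ q) (there x∈p─q) (there x∈q) = x∈p─q⇒x∉q p q x∈p─q x∈q
x∈p─q⇒x∉q (_ ∷ p) (outside ∷ q) (there x∈p─q) (there x∈q) = x∈p─q⇒x∉q p q x∈p─q x∈q

x∈p∧y∉p⇒x≢y : ∀ {n} {p : Subset n} {x y} → x ∈ p → y ∉ p → x ≢ y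
x∈p∧y∉p⇒x≢y x∈p y∉p refl = y∉p x∈p

x∈p-y⇒x≢y : ∀ {n} {p : Subset n} {x y} → x ∈ p - y → x ≢ y
x∈p-y⇒x≢y {p = p} {y = y} x∈p-y refl = x∈p─q⇒x∉q p ⁅ y ⁆ x∈p-y (x∈⁅x⁆ y)

∣p∣≤1+∣p-x∣ : ∀ {n} (p : Subset n) x → ∣ p ∣ ≤ suc ∣ p - x ∣
∣p∣≤1+∣p-x∣ (inside ∷ p) zero = s≤s (≤-reflexive (cong ∣_∣ (sym (p─⊥≡p p))))
∣p∣≤1+∣p-x∣ (outside ∷ p) zero = ≤-trans (≤-reflexive (cong ∣_∣ (sym (p─⊥≡p p)))) (n≤1+n _)
∣p∣≤1+∣p-x∣ (inside ∷ p) (suc x) = s≤s (∣p∣≤1+∣p-x∣ p x)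
∣p∣≤1+∣p-x∣ (outside ∷ p) (suc x) = ∣p∣≤1+∣p-x∣ p x

length≤∣p∣ : ∀ {n} {p : Subset n} {xs} → Unique xs → All (_∈ p) xs → length xs ≤ ∣ p ∣
length≤∣p∣ [] [] = z≤n
length≤∣p∣ (x≢xs ∷ uxs) (x∈p ∷ xs∈p) = ≤-trans
  (s≤s (length≤∣p∣ uxs (All.zipWith (λ (x≢y , y∈p) → x∈p∧x≢y⇒x∈p-y y∈p (x≢y ∘ sym)) (x≢xs , xs∈p))))
  (x∈p⇒∣p-x∣<∣p∣ x∈p)

∣p∣≤length : ∀ {n} {p : Subset n} xs → (∀ {x} → x ∈ p → x ∈ₗ xs) → ∣ p ∣ ≤ length xs
∣p∣≤length {n} {p} [] p⊆xs = ≤-reflexive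
  (trans (cong ∣_∣ (Empty-unique λ (_ , x∈p) → contradiction (p⊆xs x∈p) λ ())) (∣⊥∣≡0 n))
∣p∣≤length {p = p} (y ∷ xs) p⊆xs = ≤-trans (∣p∣≤1+∣p-x∣ p y) (s≤s (∣p∣≤length xs λ x∈p-y →
  Any.tail (x∈p-y⇒x≢y x∈p-y) (p⊆xs (p─q⊆p p ⁅ y ⁆ x∈p-y))))

fresh : ∀ {n} (xs : List (Fin n)) (p : Subset n) → length xs < ∣ p ∣ → ∃ λ x → x ∈ p × x ∉ₗ xs
fresh xs p ∣xs∣<∣p∣ with any? (λ x → (x ∈? p) ×-dec ¬? (x ∈ₗ? xs))
... | yes found = found
... | no none = contradiction
  (∣p∣≤length xs λ {x} x∈p → decidable-stable (x ∈ₗ? xs) λ x∉xs → none (x , x∈p , x∉xs))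
  (<⇒≱ ∣xs∣<∣p∣)

∷-unique : ∀ {A : Set} {x : A} {xs} → x ∉ₗ xs → Unique xs → Unique (x ∷ xs)
∷-unique x∉xs uxs = ¬Any⇒All¬ _ x∉xs ∷ uxs

-- One more element of `p` would extend the list to a duplicate-free one longer than `∣ p ∣`. Later
-- counting arguments end here: once `2 * k` elements of a member are known, it has no others.
unique∧∣p∣≤length⇒covers : ∀ {n} {p : Subset n} {xs} → Unique xs → All (_∈ p) xs → ∣ p ∣ ≤ length xs →
  ∀ {x} → x ∈ p → x ∈ₗ xs
unique∧∣p∣≤length⇒covers {xs = xs} uxs xs∈p ∣p∣≤∣xs∣ {x} x∈p = decidable-stable (x ∈ₗ? xs) λ x∉xs →
  <⇒≱ (length≤∣p∣ (∷-unique x∉xs uxs) (x∈p ∷ xs∈p)) ∣p∣≤∣xs∣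

elements : ∀ {n} → Subset n → List (Fin n)
elements {n} p = filter (_∈? p) (allFin n)

module _ {n : ℕ} {p : Subset n} where

  ∈-elements⁺ : ∀ {x} → x ∈ p → x ∈ₗ elements p
  ∈-elements⁺ x∈p = ∈-filter⁺ (_∈? p) (∈-allFin _) x∈p

  ∈-elements⁻ : ∀ {x} → x ∈ₗ elements p → x ∈ p
  ∈-elements⁻ x∈ = proj₂ (∈-filter⁻ (_∈? p) {xs = allFin n} x∈)

  elements-unique : Unique (elements p)
  elements-unique = filter⁺ (_∈? p) (allFin⁺ n)

length-elements : ∀ {n} (p : Subset n) → length (elements p) ≡ ∣ p ∣
length-elements p = ≤-antisym
  (length≤∣p∣ elements-unique (all-filter (_∈? p) (allFin _))) (∣p∣≤length {p = p} _ ∈-elements⁺)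

fromList : ∀ {n} → List (Fin n) → Subset n
fromList [] = ⊥
fromList (x ∷ xs) = ⁅ x ⁆ ∪ fromList xs

∈-fromList⁺ : ∀ {n} {x : Fin n} {xs} → x ∈ₗ xs → x ∈ fromList xs
∈-fromList⁺ {xs = y ∷ xs} (here refl) = x∈p∪q⁺ (inj₁ (x∈⁅x⁆ y))
∈-fromList⁺ {xs = y ∷ xs} (there x∈xs) = x∈p∪q⁺ (inj₂ (∈-fromList⁺ x∈xs))

∈-fromList⁻ : ∀ {n} {x : Fin n} xs → x ∈ fromList xs → x ∈ₗ xs
∈-fromList⁻ [] x∈⊥ = contradiction x∈⊥ ∉⊥
∈-fromList⁻ (y ∷ xs) x∈ with x∈p∪q⁻ ⁅ y ⁆ (fromList xs) x∈
... | inj₁ x∈⁅y⁆ = here (x∈⁅y⁆⇒x≡y y x∈⁅y⁆)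
... | inj₂ x∈xs = there (∈-fromList⁻ xs x∈xs)

∣fromList∣≤length : ∀ {n} (xs : List (Fin n)) → ∣ fromList xs ∣ ≤ length xs
∣fromList∣≤length xs = ∣p∣≤length xs (∈-fromList⁻ xs)

∣fromList∣≡length : ∀ {n} {xs : List (Fin n)} → Unique xs → ∣ fromList xs ∣ ≡ length xs
∣fromList∣≡length {xs = xs} uxs = ≤-antisym (∣fromList∣≤length xs) (length≤∣p∣ uxs (All.tabulate ∈-fromList⁺))

module _ {n : ℕ} {p q r : Subset n} where

  private
    length-elements-++ : length (elements p ++ elements q) ≡ ∣ p ∣ + ∣ q ∣
    length-elements-++ = trans (length-++ (elements p)) (cong₂ _+_ (length-elements p) (length-elements q))

  ∣r∣≤∣p∣+∣q∣ : (∀ {x} → x ∈ r → x ∈ p ⊎ x ∈ q) → ∣ r ∣ ≤ ∣ p ∣ + ∣ q ∣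
  ∣r∣≤∣p∣+∣q∣ r⊆p∪q = ≤-trans
    (∣p∣≤length (elements p ++ elements q) λ x∈r →
      [ ∈-++⁺ˡ ∘ ∈-elements⁺ , ∈-++⁺ʳ (elements p) ∘ ∈-elements⁺ ]′ (r⊆p∪q x∈r))
    (≤-reflexive length-elements-++)

  ∣p∣+∣q∣≤∣r∣ : p ⊆ r → q ⊆ r → (∀ {x} → x ∈ p → x ∉ q) → ∣ p ∣ + ∣ q ∣ ≤ ∣ r ∣
  ∣p∣+∣q∣≤∣r∣ p⊆r q⊆r p∩q=∅ = ≤-trans (≤-reflexive (sym length-elements-++))
    (length≤∣p∣ (++⁺ elements-unique elements-unique λ (x∈p , x∈q) → p∩q=∅ (∈-elements⁻ x∈p) (∈-elements⁻ x∈q))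
      (All.tabulate λ x∈ → [ p⊆r ∘ ∈-elements⁻ , q⊆r ∘ ∈-elements⁻ ]′ (∈-++⁻ (elements p) x∈)))

∣p∪⁅x⁆∣≡1+∣p∣ : ∀ {n} {p : Subset n} {x} → x ∉ p → ∣ p ∪ ⁅ x ⁆ ∣ ≡ suc ∣ p ∣
∣p∪⁅x⁆∣≡1+∣p∣ {p = p} {x} x∉p = trans (≤-antisym
  (∣r∣≤∣p∣+∣q∣ (x∈p∪q⁻ p ⁅ x ⁆))
  (∣p∣+∣q∣≤∣r∣ (p⊆p∪q ⁅ x ⁆) (q⊆p∪q p ⁅ x ⁆) λ y∈p y∈x → x∉p (subst (_∈ p) (x∈⁅y⁆⇒x≡y x y∈x) y∈p)))
  (trans (cong (∣ p ∣ +_) (∣⁅x⁆∣≡1 x)) (+-comm ∣ p ∣ 1))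

p-x⊆q⇒p⊆q : ∀ {n} (p : Subset n) {q x} → p - x ⊆ q → x ∈ q → p ⊆ q
p-x⊆q⇒p⊆q p {x = x} p-x⊆q x∈q {y} y∈p with y ≟ x
... | yes refl = x∈q
... | no y≢x = p-x⊆q (x∈p∧x≢y⇒x∈p-y y∈p y≢x)

-- Matroids

module _ {n : ℕ} (M : Matroid n) where
  open Matroid M

  -- `k` is fuel that bounds how far `X` falls short of `Y` in size; each use of `I3` lowers it by
  -- one. Keeping `B` inside `X ∪ Y` later shows where its elements come from.
  augment : ∀ k {X Y} → Indep X → Indep Y → ∣ Y ∣ ≤ k + ∣ X ∣ →
    ∃ λ B → Indep B × X ⊆ B × B ⊆ X ∪ Y × ∣ Y ∣ ≤ ∣ B ∣
  augment zero {X} {Y} iX iY ∣Y∣≤∣X∣ = X , iX , (λ x∈X → x∈X) , p⊆p∪q Y , ∣Y∣≤∣X∣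
  augment (suc k) {X} {Y} iX iY ∣Y∣≤ with ∣ Y ∣ ≤? ∣ X ∣
  ... | yes ∣Y∣≤∣X∣ = X , iX , (λ x∈X → x∈X) , p⊆p∪q Y , ∣Y∣≤∣X∣
  ... | no ∣Y∣≰∣X∣ with I3 iX iY (≰⇒> ∣Y∣≰∣X∣)
  ... | y , y∈Y , y∉X , iX∪y with augment k iX∪y iY
        (≤-trans ∣Y∣≤ (≤-reflexive (sym (trans (cong (k +_) (∣p∪⁅x⁆∣≡1+∣p∣ y∉X)) (+-suc k ∣ X ∣)))))
  ... | B , iB , X∪y⊆B , B⊆ , ∣Y∣≤∣B∣ = B , iB , X∪y⊆B ∘ p⊆p∪q ⁅ y ⁆ , B⊆X∪Y , ∣Y∣≤∣B∣
    where
    B⊆X∪Y : B ⊆ X ∪ Y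
    B⊆X∪Y x∈B with x∈p∪q⁻ (X ∪ ⁅ y ⁆) Y (B⊆ x∈B)
    ... | inj₂ x∈Y = x∈p∪q⁺ (inj₂ x∈Y)
    ... | inj₁ x∈X∪y with x∈p∪q⁻ X ⁅ y ⁆ x∈X∪y
    ... | inj₁ x∈X = x∈p∪q⁺ (inj₁ x∈X)
    ... | inj₂ x∈y = x∈p∪q⁺ (inj₂ (subst (_∈ Y) (sym (x∈⁅y⁆⇒x≡y y x∈y)) y∈Y))

  extend : ∀ {X Y} → Indep X → Indep Y → ∃ λ B → Indep B × X ⊆ B × B ⊆ X ∪ Y × ∣ Y ∣ ≤ ∣ B ∣
  extend {X} {Y} iX iY = augment ∣ Y ∣ iX iY (m≤m+n ∣ Y ∣ ∣ X ∣)

  indep≤basis : ∀ {X B} → Indep X → IsBasis M B → ∣ X ∣ ≤ ∣ B ∣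
  indep≤basis {X} {B} iX (iB , maxB) = ≮⇒≥ λ ∣B∣<∣X∣ →
    let y , _ , y∉B , iB∪y = I3 iB iX ∣B∣<∣X∣
    in y∉B (subst (y ∈_) (maxB _ iB∪y (p⊆p∪q ⁅ y ⁆)) (q⊆p∪q B ⁅ y ⁆ (x∈⁅x⁆ y)))

  large⇒basis : ∀ {B B′} → IsBasis M B → Indep B′ → ∣ B ∣ ≤ ∣ B′ ∣ → IsBasis M B′
  large⇒basis {B} {B′} bB iB′ ∣B∣≤∣B′∣ = iB′ , λ X iX B′⊆X → ⊆-antisym
    (λ {x} x∈X → decidable-stable (x ∈? B′) λ x∉B′ →
      <⇒≱ (p⊂q⇒∣p∣<∣q∣ (B′⊆X , x , x∈X , x∉B′)) (≤-trans (indep≤basis iX bB) ∣B∣≤∣B′∣))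
    B′⊆X

  circuit-delete : ∀ {C x} → IsCircuit M C → x ∈ C → Indep (C - x)
  circuit-delete (_ , minC) x∈C = minC _ (x∈p⇒p-x⊂p x∈C)

  -- If C ∩ D = {x}, take a basis B with B ∩ D = {x}: extending C - x from B avoids x, giving a basis that misses D.
  circuit-cocircuit-orthogonal : ∀ {C D x} → IsCircuit M C → IsCocircuit M D → x ∈ C → x ∈ D →
    ∃ λ y → y ≢ x × y ∈ C × y ∈ D
  circuit-cocircuit-orthogonal {C} {D} {x} cC (depD , minD) x∈C x∈D
    with any? (λ y → ¬? (y ≟ x) ×-dec (y ∈? C) ×-dec (y ∈? D))
  ... | yes found = found
  ... | no none = contradiction D-x-dependent (minD (D - x) (x∈p⇒p-x⊂p x∈D))
    where
    D-x-dependent : DualDependent M (D - x)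
    D-x-dependent B bB = decidable-stable (nonempty? ((D - x) ∩ B)) λ D-x∩B=∅ →
      let B′ , iB′ , C-x⊆B′ , B′⊆ , ∣B∣≤∣B′∣ = extend (circuit-delete cC x∈C) (proj₁ bB)
          y , y∈D∩B′ = depD B′ (large⇒basis bB iB′ ∣B∣≤∣B′∣)
          y∈D , y∈B′ = x∈p∩q⁻ D B′ y∈D∩B′
          x∉B′ = λ x∈B′ → proj₁ cC (I2 (p-x⊆q⇒p⊆q C C-x⊆B′ x∈B′) iB′)
          y≢x = λ y≡x → x∉B′ (subst (_∈ B′) y≡x y∈B′)
      in [ (λ y∈C-x → none (y , y≢x , p─q⊆p C ⁅ x ⁆ y∈C-x , y∈D))
         , (λ y∈B → D-x∩B=∅ (y , x∈p∩q⁺ (x∈p∧x≢y⇒x∈p-y y∈D y≢x , y∈B))) ]′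
         (x∈p∪q⁻ (C - x) B (B′⊆ y∈B′))

  -- Elements are deleted as long as the set stays dependent, with `k` as fuel. When no deletion is
  -- possible, every proper subset lies in an independent `U - x`, so `U` itself is a circuit.
  dependent⇒circuit : ∀ k {U} → ∣ U ∣ ≤ k → ¬ Indep U → ∃ λ C → IsCircuit M C × C ⊆ U
  dependent⇒circuit k {U} ∣U∣≤k dU with any? (λ x → (x ∈? U) ×-dec ¬? (Indep? (U - x)))
  dependent⇒circuit zero ∣U∣≤0 dU | yes (x , x∈U , _) = contradiction (<-≤-trans (x∈p⇒∣p-x∣<∣p∣ x∈U) ∣U∣≤0) λ ()
  dependent⇒circuit (suc k) {U} ∣U∣≤k dU | yes (x , x∈U , dU-x)
    with dependent⇒circuit k (≤-pred (<-≤-trans (x∈p⇒∣p-x∣<∣p∣ x∈U) ∣U∣≤k)) dU-x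
  ... | C , cC , C⊆U-x = C , cC , p─q⊆p U ⁅ x ⁆ ∘ C⊆U-x
  dependent⇒circuit k {U} ∣U∣≤k dU | no none = U , (dU , minU) , λ x∈U → x∈U
    where
    minU : ∀ D → D ⊂ U → Indep D
    minU D (D⊆U , x , x∈U , x∉D) = I2
      (λ y∈D → x∈p∧x≢y⇒x∈p-y (D⊆U y∈D) λ { refl → x∉D y∈D })
      (decidable-stable (Indep? (U - x)) λ dU-x → none (x , x∈U , dU-x))

  circuit-nonempty : ∀ {C} → IsCircuit M C → Nonempty C
  circuit-nonempty {C} (dC , _) = decidable-stable (nonempty? C) λ C=∅ → dC (subst Indep (sym (Empty-unique C=∅)) I1)

  -- The difference of size and rank is at least `k`, stated through independent subsets to avoid a
  -- rank function and subtraction.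
  Nullity≥ : ℕ → Subset n → Set
  Nullity≥ k U = ∀ {I} → Indep I → I ⊆ U → ∣ I ∣ + k ≤ ∣ U ∣

  -- The part of `I` in `U` has at least `k` elements fewer than `U`, and the rest of `I` fits into
  -- what `V` has outside `U`.
  nullity-mono : ∀ {k U V} → U ⊆ V → Nullity≥ k U → Nullity≥ k V
  nullity-mono {k} {U} {V} U⊆V nU {I} iI I⊆V = begin
    ∣ I ∣ + k                  ≤⟨ +-monoˡ-≤ k (∣r∣≤∣p∣+∣q∣ split) ⟩
    ∣ I ∩ U ∣ + ∣ I ─ U ∣ + k  ≡⟨ cong (_+ k) (+-comm ∣ I ∩ U ∣ _) ⟩
    ∣ I ─ U ∣ + ∣ I ∩ U ∣ + k  ≡⟨ +-assoc ∣ I ─ U ∣ _ k ⟩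
    ∣ I ─ U ∣ + (∣ I ∩ U ∣ + k) ≤⟨ +-monoʳ-≤ ∣ I ─ U ∣ (nU (I2 (p∩q⊆p I U) iI) (p∩q⊆q I U)) ⟩
    ∣ I ─ U ∣ + ∣ U ∣          ≤⟨ ∣p∣+∣q∣≤∣r∣ (I⊆V ∘ p─q⊆p I U) U⊆V (x∈p─q⇒x∉q I U) ⟩
    ∣ V ∣                      ∎
    where
    open ≤-Reasoning
    split : ∀ {x} → x ∈ I → x ∈ I ∩ U ⊎ x ∈ I ─ U
    split {x} x∈I with x ∈? U
    ... | yes x∈U = inj₁ (x∈p∩q⁺ (x∈I , x∈U))
    ... | no x∉U = inj₂ (x∈p∧x∉q⇒x∈p─q x∈I x∉U)

  -- Extending `C - x` by elements of `I` gives an independent `B` at least as large as `I`. It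
  -- cannot contain `x`, or it would contain `C`; so it lies in `V`, and `x` adds to the size
  -- without adding to the rank.
  nullity-circuit : ∀ {k V C x} → IsCircuit M C → x ∈ C → x ∉ V → C - x ⊆ V → Nullity≥ k V →
    Nullity≥ (suc k) (V ∪ ⁅ x ⁆)
  nullity-circuit {k} {V} {C} {x} cC x∈C x∉V C-x⊆V nV {I} iI I⊆V∪x
    with extend (circuit-delete cC x∈C) iI
  ... | B , iB , C-x⊆B , B⊆ , ∣I∣≤∣B∣ = begin
    ∣ I ∣ + suc k  ≡⟨ +-suc ∣ I ∣ k ⟩
    suc (∣ I ∣ + k) ≤⟨ s≤s (+-monoˡ-≤ k ∣I∣≤∣B∣) ⟩
    suc (∣ B ∣ + k) ≤⟨ s≤s (nV iB B⊆V) ⟩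
    suc ∣ V ∣      ≡⟨ sym (∣p∪⁅x⁆∣≡1+∣p∣ x∉V) ⟩
    ∣ V ∪ ⁅ x ⁆ ∣  ∎
    where
    open ≤-Reasoning
    B⊆V∪x : ∀ {y} → y ∈ B → y ∈ V ⊎ y ∈ ⁅ x ⁆
    B⊆V∪x y∈B with x∈p∪q⁻ (C - x) I (B⊆ y∈B)
    ... | inj₁ y∈C-x = inj₁ (C-x⊆V y∈C-x)
    ... | inj₂ y∈I = x∈p∪q⁻ V ⁅ x ⁆ (I⊆V∪x y∈I)
    B⊆V : B ⊆ V
    B⊆V y∈B with B⊆V∪x y∈B
    ... | inj₁ y∈V = y∈V
    ... | inj₂ y∈x = contradiction
      (I2 (p-x⊆q⇒p⊆q C C-x⊆B (subst (_∈ B) (x∈⁅y⁆⇒x≡y x y∈x) y∈B)) iB) (proj₁ cC)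

-- Families of subsets covering all small sets

-- An abstract family lets the same lemmas serve circuits and cocircuits, without constructing the
-- dual matroid.
record Covering {n : ℕ} (𝒞 : Subset n → Set) (k : ℕ) : Set where
  field
    size  : ∀ {C} → 𝒞 C → ∣ C ∣ ≡ 2 * k
    cover : ∀ {xs} → Unique xs → length xs ≤ k → ∃ λ C → 𝒞 C × All (_∈ C) xs

  length-members : ∀ {C} → 𝒞 C → length (elements C) ≡ 2 * k
  length-members {C} 𝒞C = trans (length-elements C) (size 𝒞C)

Sized : ∀ {n} → (Subset n → Set) → ℕ → Subset n → Set
Sized 𝒞 k C = 𝒞 C × ∣ C ∣ ≡ 2 * k

enlarge : ∀ {n} d {xs : List (Fin n)} → Unique xs → length xs + d ≤ n →
  ∃ λ ys → Unique ys × length ys ≡ length xs + d × (∀ {x} → x ∈ₗ xs → x ∈ₗ ys)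
enlarge zero {xs} uxs _ = xs , uxs , sym (+-identityʳ _) , λ x∈xs → x∈xs
enlarge {n} (suc d) {xs} uxs ∣xs∣+1+d≤n =
  let 1+∣xs∣+d≤n = ≤-trans (≤-reflexive (sym (+-suc (length xs) d))) ∣xs∣+1+d≤n
      x , _ , x∉xs = fresh xs ⊤ (≤-trans (s≤s (m≤m+n _ d)) (≤-trans 1+∣xs∣+d≤n (≤-reflexive (sym (∣⊤∣≡n n)))))
      ys , uys , ∣ys∣≡ , xs⊆ys = enlarge d (∷-unique x∉xs uxs) 1+∣xs∣+d≤n
  in ys , uys , trans ∣ys∣≡ (sym (+-suc (length xs) d)) , xs⊆ys ∘ there

-- A list with fewer than `k` entries is first padded to exactly `k` distinct elements, for which
-- `k ≤ n` leaves room.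
covering : ∀ {n k} {𝒞 : Subset n → Set} → k ≤ n →
  (∀ X → ∣ X ∣ ≡ k → ∃ λ C → X ⊆ C × 𝒞 C × ∣ C ∣ ≡ 2 * k) → Covering (Sized 𝒞 k) k
covering {n} {k} {𝒞} k≤n cov = record { size = proj₂ ; cover = cover }
  where
  cover : ∀ {xs} → Unique xs → length xs ≤ k → ∃ λ C → Sized 𝒞 k C × All (_∈ C) xs
  cover uxs ∣xs∣≤k with m≤n⇒∃[o]m+o≡n ∣xs∣≤k
  ... | d , refl =
    let ys , uys , ∣ys∣≡k , xs⊆ys = enlarge d uxs k≤n
        C , ys⊆C , 𝒞C , ∣C∣≡2k = cov (fromList ys) (trans (∣fromList∣≡length uys) ∣ys∣≡k)
    in C , (𝒞C , ∣C∣≡2k) , All.tabulate (ys⊆C ∘ ∈-fromList⁺ ∘ xs⊆ys)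

-- Bounded circuits off a given set

module _ {n a : ℕ} (M : Matroid n) (cov : Covering (Sized (IsCircuit M) (suc a)) (suc a)) where
  open Matroid M
  open Covering cov

  -- Each round takes some `x` outside the current set and a circuit of size `2 * suc a` through it.
  -- The rest of the circuit goes in first, which preserves the nullity bound; adding `x` last
  -- raises it by one.
  large-nullity : ∀ k (W : Subset n) → ∣ W ∣ + k * (2 * suc a) ≤ n →
    ∃ λ U → W ⊆ U × ∣ U ∣ ≤ ∣ W ∣ + k * (2 * suc a) × Nullity≥ M k U
  large-nullity zero W _ = W , (λ x∈W → x∈W) , m≤m+n _ _ ,
    λ {I} _ I⊆W → ≤-trans (≤-reflexive (+-identityʳ _)) (p⊆q⇒∣p∣≤∣q∣ {p = I} I⊆W)
  large-nullity (suc k) W bound with large-nullity k W (≤-trans (+-monoʳ-≤ ∣ W ∣ (m≤n+m _ (2 * suc a))) bound)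
  ... | U , W⊆U , ∣U∣≤ , nU with fresh (elements U) ⊤ ∣U∣<n
    where
    open ≤-Reasoning
    ∣U∣<n : length (elements U) < ∣ ⊤ {n} ∣
    ∣U∣<n = begin-strict
      length (elements U)           ≡⟨ length-elements U ⟩
      ∣ U ∣                         ≤⟨ ∣U∣≤ ⟩
      ∣ W ∣ + k * (2 * suc a)       <⟨ +-monoʳ-< ∣ W ∣ (m<n+m _ {2 * suc a} (s≤s z≤n)) ⟩
      ∣ W ∣ + suc k * (2 * suc a)   ≤⟨ bound ⟩
      n                             ≡⟨ sym (∣⊤∣≡n n) ⟩
      ∣ ⊤ {n} ∣                     ∎
  ... | x , _ , x∉elU with cover {x ∷ []} ([] ∷ []) (s≤s z≤n)
  ... | C , (cC , ∣C∣≡) , x∈C ∷ [] =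
    V ∪ ⁅ x ⁆ , p⊆p∪q ⁅ x ⁆ ∘ p⊆p∪q (C - x) ∘ W⊆U , ∣V∪x∣≤ ,
    nullity-circuit M cC x∈C x∉V (q⊆p∪q U (C - x)) (nullity-mono M (p⊆p∪q (C - x)) nU)
    where
    V = U ∪ (C - x)
    x∉V : x ∉ V
    x∉V x∈V = [ x∉elU ∘ ∈-elements⁺ , (λ x∈C-x → x∈p-y⇒x≢y {p = C} x∈C-x refl) ]′ (x∈p∪q⁻ U (C - x) x∈V)
    split : ∀ {y} → y ∈ V ∪ ⁅ x ⁆ → y ∈ U ⊎ y ∈ C
    split y∈ with x∈p∪q⁻ V ⁅ x ⁆ y∈
    ... | inj₂ y∈x = inj₂ (subst (_∈ C) (sym (x∈⁅y⁆⇒x≡y x y∈x)) x∈C)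
    ... | inj₁ y∈V with x∈p∪q⁻ U (C - x) y∈V
    ... | inj₁ y∈U = inj₁ y∈U
    ... | inj₂ y∈C-x = inj₂ (p─q⊆p C ⁅ x ⁆ y∈C-x)
    open ≤-Reasoning
    ∣V∪x∣≤ : ∣ V ∪ ⁅ x ⁆ ∣ ≤ ∣ W ∣ + suc k * (2 * suc a)
    ∣V∪x∣≤ = begin
      ∣ V ∪ ⁅ x ⁆ ∣                           ≤⟨ ∣r∣≤∣p∣+∣q∣ split ⟩
      ∣ U ∣ + ∣ C ∣                           ≤⟨ +-mono-≤ ∣U∣≤ (≤-reflexive ∣C∣≡) ⟩
      ∣ W ∣ + k * (2 * suc a) + 2 * suc a     ≡⟨ +-assoc ∣ W ∣ _ _ ⟩
      ∣ W ∣ + (k * (2 * suc a) + 2 * suc a)   ≡⟨ cong (∣ W ∣ +_) (+-comm (k * (2 * suc a)) _) ⟩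
      ∣ W ∣ + suc k * (2 * suc a)             ∎

  -- Deleting W lowers the nullity by at most ∣ W ∣, so a set of nullity exceeding ∣ W ∣ stays dependent off W.
  circuit-avoiding : ∀ (W : Subset n) → ∣ W ∣ + suc ∣ W ∣ * (2 * suc a) ≤ n →
    ∃ λ C → IsCircuit M C × (∀ {x} → x ∈ C → x ∉ W) × ∣ C ∣ ≤ ∣ W ∣ + suc ∣ W ∣ * (2 * suc a)
  circuit-avoiding W bound with large-nullity (suc ∣ W ∣) W bound
  ... | U , W⊆U , ∣U∣≤ , nU with dependent⇒circuit M ∣ U ─ W ∣ ≤-refl U─W-dependent
    where
    open ≤-Reasoning
    split : ∀ {x} → x ∈ U → x ∈ U ─ W ⊎ x ∈ W
    split {x} x∈U with x ∈? W
    ... | yes x∈W = inj₂ x∈W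
    ... | no x∉W = inj₁ (x∈p∧x∉q⇒x∈p─q x∈U x∉W)
    U─W-dependent : ¬ Indep (U ─ W)
    U─W-dependent iU─W = n≮n ∣ U ∣ (begin-strict
      ∣ U ∣                   ≤⟨ ∣r∣≤∣p∣+∣q∣ split ⟩
      ∣ U ─ W ∣ + ∣ W ∣       <⟨ +-monoʳ-< ∣ U ─ W ∣ (n<1+n _) ⟩
      ∣ U ─ W ∣ + suc ∣ W ∣   ≤⟨ nU iU─W (p─q⊆p U W) ⟩
      ∣ U ∣                   ∎)
  ... | C , cC , C⊆U─W = C , cC , x∈p─q⇒x∉q U W ∘ C⊆U─W ,
    ≤-trans (p⊆q⇒∣p∣≤∣q∣ {p = C} (p─q⊆p U W ∘ C⊆U─W)) ∣U∣≤

-- Lists of pairwise disjoint blocks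

AllPairs-resp-⊑ : ∀ {A : Set} {R : A → A → Set} {xs ys} → xs ⊑ ys → AllPairs R ys → AllPairs R xs
AllPairs-resp-⊑ [] [] = []
AllPairs-resp-⊑ (_ ∷ʳ xs⊑ys) (_ ∷ pys) = AllPairs-resp-⊑ xs⊑ys pys
AllPairs-resp-⊑ (refl ∷ xs⊑ys) (py ∷ pys) = All-resp-⊆ xs⊑ys py ∷ AllPairs-resp-⊑ xs⊑ys pys

module _ {A : Set} {n : ℕ} (f : A → List (Fin n)) where

  -- Since the blocks are pairwise disjoint, `w` lies in at most one of them, so at most one entry
  -- is lost.
  discard : ∀ w {xs} → AllPairs (Disjoint on f) xs →
    ∃ λ ys → ys ⊑ xs × length xs ≤ suc (length ys) × All (λ y → w ∉ₗ f y) ys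
  discard w [] = [] , [] , z≤n , []
  discard w {x ∷ xs} (x#xs ∷ pxs) with w ∈ₗ? f x
  ... | yes w∈x = xs , x ∷ʳ ⊑-refl , ≤-refl , All.map (λ x#y w∈y → x#y (w∈x , w∈y)) x#xs
  ... | no w∉x = let ys , ys⊑xs , ∣xs∣≤ , w∉ys = discard w pxs in x ∷ ys , refl ∷ ys⊑xs , s≤s ∣xs∣≤ , w∉x ∷ w∉ys

  discard-all : ∀ W {xs} → AllPairs (Disjoint on f) xs →
    ∃ λ ys → ys ⊑ xs × length xs ≤ length W + length ys × All (λ y → Disjoint (f y) W) ys
  discard-all [] {xs} _ = xs , ⊑-refl , ≤-refl , All.universal (λ { _ (_ , ()) }) xs
  discard-all (w ∷ W) pxs =
    let ys , ys⊑xs , ∣xs∣≤ , w∉ys = discard w pxs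
        zs , zs⊑ys , ∣ys∣≤ , zs#W = discard-all W (AllPairs-resp-⊑ ys⊑xs pxs)
    in zs , ⊑-trans zs⊑ys ys⊑xs , ≤-trans ∣xs∣≤ (s≤s ∣ys∣≤) ,
       All.zipWith (λ { (w∉z , _) (v∈z , here refl) → w∉z v∈z ; (_ , z#W) (v∈z , there v∈W) → z#W (v∈z , v∈W) })
         (All-resp-⊆ zs⊑ys w∉ys , zs#W)

  avoid : ∀ W r {xs} → AllPairs (Disjoint on f) xs → length W + r ≤ length xs →
    ∃ λ ys → ys ⊑ xs × length ys ≡ r × All (λ y → Disjoint (f y) W) ys
  avoid W r pxs bound =
    let ys , ys⊑xs , ∣xs∣≤ , ys#W = discard-all W pxs
    in take r ys , ⊑-trans (take-⊆ r ys) ys⊑xs ,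
       trans (length-take r ys) (m≤n⇒m⊓n≡m (+-cancelˡ-≤ (length W) _ _ (≤-trans bound ∣xs∣≤))) ,
       All-resp-⊆ (take-⊆ r ys) ys#W

  record Packing (d : ℕ) : Set where
    field
      items    : List A
      len      : length items ≡ d
      disjoint : AllPairs (Disjoint on f) items

    support : List (Fin n)
    support = concatMap f items

  -- The form of one greedy choice: the bounds on the new block and on `n` depend only on a bound
  -- for the number of excluded elements. `pack` returns the same form for packings, so it can be
  -- applied to its own result to obtain disjoint groups of disjoint blocks.
  Available : (g h : ℕ → ℕ) → Set
  Available g h = ∀ {w} W → length W ≤ w → h w ≤ n → ∃ λ a → Disjoint (f a) W × length (f a) ≤ g w

open Packing using (items; len; support)

-- After the first block the excluded elements may number `w + g w`, hence the shifted argument here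
-- and in `packNeed`.
packSize : (ℕ → ℕ) → ℕ → ℕ → ℕ
packSize g zero w = 0
packSize g (suc d) w = g w + packSize g d (w + g w)

packNeed : (g h : ℕ → ℕ) → ℕ → ℕ → ℕ
packNeed g h zero w = 0
packNeed g h (suc d) w = h w + packNeed g h d (w + g w)

block⊆ : ∀ {A : Set} {n} (f : A → List (Fin n)) {xs v} → ∀ {x} → x ∈ₗ xs → v ∈ₗ f x → v ∈ₗ concatMap f xs
block⊆ f (here refl) v∈x = ∈-++⁺ˡ v∈x
block⊆ f {y ∷ _} (there x∈xs) v∈x = ∈-++⁺ʳ (f y) (block⊆ f x∈xs v∈x)

pack : ∀ {A : Set} {n} (f : A → List (Fin n)) {g h} → Available f g h →
  ∀ d → Available (support {f = f} {d}) (packSize g d) (packNeed g h d)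
pack f av zero W _ _ = record { items = [] ; len = refl ; disjoint = [] } , (λ { (() , _) }) , z≤n
pack f {g} {h} av (suc d) {w} W ∣W∣≤w need =
  let a , a#W , ∣a∣≤ = av W ∣W∣≤w (≤-trans (m≤m+n (h w) _) need)
      p , p#W++a , ∣p∣≤ = pack f av d (W ++ f a)
        (≤-trans (≤-reflexive (length-++ W)) (+-mono-≤ ∣W∣≤w ∣a∣≤))
        (≤-trans (m≤n+m _ (h w)) need)
  in record { items = a ∷ items p ; len = cong suc (len p)
            ; disjoint = All.tabulate (λ x∈p (v∈a , v∈x) → p#W++a (block⊆ f x∈p v∈x , ∈-++⁺ʳ W v∈a)) ∷ Packing.disjoint p }
     , (λ (v∈ , v∈W) → [ (λ v∈a → a#W (v∈a , v∈W)) , (λ v∈p → p#W++a (v∈p , ∈-++⁺ˡ v∈W)) ]′ (∈-++⁻ (f a) v∈))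
     , ≤-trans (≤-reflexive (length-++ (f a))) (+-mono-≤ ∣a∣≤ ∣p∣≤)

-- The pigeonhole principle for sublists

module _ {A B : Set} (Q : A → B → Set) where

  private
    Chosen : List B → A → Set
    Chosen zs x = ∃ λ z → z ∈ₗ zs × Q x z

  split-chosen : ∀ {z zs xs} → All (Chosen (z ∷ zs)) xs →
    ∃ λ ys → ∃ λ ys′ → ys ⊑ xs × ys′ ⊑ xs × length xs ≡ length ys + length ys′ ×
      All (λ y → Q y z) ys × All (Chosen zs) ys′
  split-chosen [] = [] , [] , [] , [] , refl , [] , []
  split-chosen {xs = x ∷ xs} ((_ , here refl , q) ∷ qs) =
    let ys , ys′ , ys⊑ , ys′⊑ , eq , qys , qys′ = split-chosen qs
    in x ∷ ys , ys′ , refl ∷ ys⊑ , x ∷ʳ ys′⊑ , cong suc eq , q ∷ qys , qys′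
  split-chosen {xs = x ∷ xs} ((_ , there z∈zs , q) ∷ qs) =
    let ys , ys′ , ys⊑ , ys′⊑ , eq , qys , qys′ = split-chosen qs
    in ys , x ∷ ys′ , x ∷ʳ ys⊑ , refl ∷ ys′⊑ , trans (cong suc eq) (sym (+-suc _ _)) , qys , (_ , z∈zs , q) ∷ qys′

  pigeonhole-⊑ : ∀ b zs {xs} → All (Chosen zs) xs → length zs * b < length xs →
    ∃ λ z → ∃ λ ys → z ∈ₗ zs × ys ⊑ xs × b < length ys × All (λ y → Q y z) ys
  pigeonhole-⊑ b [] ((_ , () , _) ∷ _) _
  pigeonhole-⊑ b (z ∷ zs) {xs} qs bound with split-chosen qs
  ... | ys , ys′ , ys⊑ , ys′⊑ , eq , qys , qys′ with suc b ≤? length ys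
  ... | yes b<∣ys∣ = z , ys , here refl , ys⊑ , b<∣ys∣ , qys
  ... | no b≮∣ys∣ =
    let z′ , ys″ , z′∈zs , ys″⊑ , b<∣ys″∣ , qys″ = pigeonhole-⊑ b zs qys′ (+-cancelˡ-< b _ _ (begin-strict
          b + length zs * b       <⟨ bound ⟩
          length xs               ≡⟨ eq ⟩
          length ys + length ys′  ≤⟨ +-monoˡ-≤ (length ys′) (≮⇒≥ b≮∣ys∣) ⟩
          b + length ys′          ∎))
    in z′ , ys″ , there z′∈zs , ⊑-trans ys″⊑ ys′⊑ , b<∣ys″∣ , qys″
    where open ≤-Reasoning

-- Tied elements

Orthogonal : ∀ {n} → (𝒞 𝒟 : Subset n → Set) → Set
Orthogonal 𝒞 𝒟 = ∀ {C D x} → 𝒞 C → 𝒟 D → x ∈ C → x ∈ D → ∃ λ y → y ≢ x × y ∈ C × y ∈ D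

_≼[_]_ : ∀ {n} → Fin n → (Subset n → Set) → Fin n → Set
x ≼[ 𝒞 ] y = ∀ {C} → 𝒞 C → x ∈ C → y ∈ C

Tied : ∀ {n} → (Subset n → Set) → Fin n × Fin n → Set
Tied 𝒞 (y , z) = y ≢ z × y ≼[ 𝒞 ] z × z ≼[ 𝒞 ] y

points : ∀ {n} → Fin n × Fin n → List (Fin n)
points (y , z) = y ∷ z ∷ []

length-points : ∀ {n} (ps : List (Fin n × Fin n)) → length (concatMap points ps) ≡ length ps * 2
length-points [] = refl
length-points (_ ∷ ps) = cong (2 +_) (length-points ps)

tied-partner : ∀ {n} {𝒞 : Subset n → Set} {ps x} → All (Tied 𝒞) ps → x ∈ₗ concatMap points ps →
  ∃ λ y → y ∈ₗ concatMap points ps × y ≢ x × x ≼[ 𝒞 ] y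
tied-partner ((y≢z , y≼z , _) ∷ _) (here refl) = _ , there (here refl) , y≢z ∘ sym , y≼z
tied-partner ((y≢z , _ , z≼y) ∷ _) (there (here refl)) = _ , here refl , y≢z , z≼y
tied-partner (_ ∷ tied) (there (there x∈ps)) =
  let y , y∈ps , y≢x , x≼y = tied-partner tied x∈ps in y , there (there y∈ps) , y≢x , x≼y

-- By `size`, `set` has exactly one element besides `e` and the tied pairs in `core`. Elements to be
-- kept out of the pairs are listed in `W`, so a set whose elements are all in `W` can meet `set`
-- only in `e` and that one element.
record Star {n : ℕ} (𝒟 : Subset n → Set) (ps : List (Fin n × Fin n)) (e : Fin n) (W : List (Fin n)) : Set where
  field
    pairs  : List (Fin n × Fin n)
    pairs⊑ : pairs ⊑ ps
    set    : Subset n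

  core : List (Fin n)
  core = concatMap points pairs

  field
    set∈    : 𝒟 set
    e∈set   : e ∈ set
    e∉core  : e ∉ₗ core
    core⊆   : All (_∈ set) core
    unique  : Unique core
    core#W  : Disjoint core W
    size    : ∣ set ∣ ≡ 2 + length core

  exhausted : ∀ {f x} → f ∈ set → f ≢ e → f ∉ₗ core → x ∈ set → x ≢ e → x ≢ f → x ∈ₗ core
  exhausted f∈set f≢e f∉core x∈set x≢e x≢f = Any.tail x≢f (Any.tail x≢e (unique∧∣p∣≤length⇒covers
    (∷-unique (λ { (here e≡f) → f≢e (sym e≡f) ; (there e∈core) → e∉core e∈core }) (∷-unique f∉core unique))
    (e∈set ∷ f∈set ∷ core⊆) (≤-reflexive size) x∈set))

  extra : ∃ λ f → f ∈ set × f ≢ e × f ∉ₗ core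
  extra = let f , f∈set , f∉ = fresh (e ∷ core) set (≤-reflexive (sym size))
          in f , f∈set , f∉ ∘ here , f∉ ∘ there

-- Each of `e` and the entries of `W` spoils at most one pair, so `b` pairs remain. A member through
-- `e` and their first elements contains the second ones too, which fixes `1 + 2 * b` of its
-- `2 * suc b` elements.
star : ∀ {n b} {𝒟 : Subset n → Set} {ps} → Covering 𝒟 (suc b) →
  AllPairs (Disjoint on points) ps → All (Tied 𝒟) ps →
  ∀ e W → suc (length W) + b ≤ length ps → Star 𝒟 ps e W
star {b = b} {𝒟} cov ps# tied e W bound with avoid points (e ∷ W) b ps# bound
... | js , js⊑ , ∣js∣≡b , js#W with Covering.cover cov {e ∷ map proj₁ js} (∷-unique e∉firsts firsts-unique)
                                      (s≤s (≤-reflexive (trans (length-map proj₁ js) ∣js∣≡b)))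
  where
  firsts-unique : Unique (map proj₁ js)
  firsts-unique = AllPairs-map⁺ (AllPairs.map (λ p#q eq → p#q (here refl , here eq)) (AllPairs-resp-⊑ js⊑ ps#))
  e∉firsts : e ∉ₗ map proj₁ js
  e∉firsts e∈ = let _ , j∈js , e≡ = ∈-map⁻ proj₁ e∈ in All.lookup js#W j∈js (here e≡ , here refl)
... | D , 𝒟D , e∈D ∷ firsts∈D = record
  { pairs  = js
  ; pairs⊑ = js⊑
  ; set    = D
  ; set∈   = 𝒟D
  ; e∈set  = e∈D
  ; e∉core = λ e∈core → core#e∷W (e∈core , here refl)
  ; core⊆  = concat⁺ (All-map⁺ (All.zipWith (λ (y∈D , (_ , y≼z , _)) → y∈D ∷ y≼z 𝒟D y∈D ∷ [])
               (All-map⁻ firsts∈D , tied-js)))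
  ; unique = unique-concat⁺ (All-map⁺ (All.map (λ (y≢z , _) → (y≢z ∷ []) ∷ [] ∷ []) tied-js))
               (AllPairs-map⁺ (AllPairs-resp-⊑ js⊑ ps#))
  ; core#W = λ (v∈core , v∈W) → core#e∷W (v∈core , there v∈W)
  ; size   = trans (Covering.size cov 𝒟D) (trans (*-comm 2 (suc b)) (cong (2 +_)
               (trans (cong (_* 2) (sym ∣js∣≡b)) (sym (length-points js)))))
  }
  where
  tied-js : All (Tied 𝒟) js
  tied-js = All-resp-⊆ js⊑ tied
  core#e∷W : Disjoint (concatMap points js) (e ∷ W)
  core#e∷W (v∈core , v∈W) = let _ , j∈js , v∈j = find (∈-concatMap⁻ points {xs = js} v∈core) in All.lookup js#W j∈js (v∈j , v∈W)

-- In a star at `e` with core off `f` and `g`, both would have to be the single element outside `e`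
-- and the core. The bound allows one spoiled pair for each of `e`, `f`, `g`.
≼-unique : ∀ {n a} {𝒞 : Subset n → Set} {ps} → Covering 𝒞 (suc a) →
  AllPairs (Disjoint on points) ps → All (Tied 𝒞) ps → 3 + a ≤ length ps →
  ∀ {e f g} → e ≢ f → e ≢ g → e ≼[ 𝒞 ] f → e ≼[ 𝒞 ] g → f ≡ g
≼-unique cov𝒞 ps# tied bound {e} {f} {g} e≢f e≢g e≼f e≼g = decidable-stable (f ≟ g) λ f≢g →
  let open Star (star cov𝒞 ps# tied e (f ∷ g ∷ []) bound)
  in core#W (exhausted (e≼f set∈ e∈set) (e≢f ∘ sym) (λ f∈core → core#W (f∈core , here refl))
               (e≼g set∈ e∈set) (e≢g ∘ sym) (f≢g ∘ sym)
            , there (here refl))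

module _ {n a b : ℕ} {𝒞 𝒟 : Subset n → Set} {ps : List (Fin n × Fin n)}
  (orth : Orthogonal 𝒞 𝒟) (cov𝒞 : Covering 𝒞 (suc a)) (cov𝒟 : Covering 𝒟 (suc b))
  (ps# : AllPairs (Disjoint on points) ps) where

  -- If `C` contained `e` but not `f`, a star at `e` in `𝒟` with core off `C` and `f` would have `f`
  -- as its extra element and meet `C` in `e` alone, against orthogonality.
  transfer : All (Tied 𝒟) ps → suc (suc (2 * suc a)) + b ≤ length ps →
    ∀ {e f} → e ≢ f → e ≼[ 𝒟 ] f → e ≼[ 𝒞 ] f
  transfer tied bound {e} {f} e≢f e≼f {C} 𝒞C e∈C = decidable-stable (f ∈? C) λ f∉C →
    let open Star (star cov𝒟 ps# tied e (f ∷ elements C)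
                     (≤-trans (≤-reflexive (cong (λ k → suc (suc k) + b) (Covering.length-members cov𝒞 𝒞C))) bound))
        x , x≢e , x∈C , x∈D = orth 𝒞C set∈ e∈C e∈set
    in core#W (exhausted (e≼f set∈ e∈set) (e≢f ∘ sym) (λ f∈core → core#W (f∈core , here refl))
                 x∈D x≢e (x∈p∧y∉p⇒x≢y x∈C f∉C)
              , there (∈-elements⁺ x∈C))

  -- Some C₀ in 𝒞 through e consists, besides e, of tied pairs and one more element f. A member D of 𝒟 through e whose
  -- other pairs avoid C₀ meets C₀ again in f, and if its pairs also avoid C then D meets C in {e, f} only.
  ≼-exists : All (Tied 𝒞) ps → All (Tied 𝒟) ps → 1 + a ≤ length ps → suc (2 * suc a + 2 * suc a) + b ≤ length ps →
    ∀ e → ∃ λ f → e ≢ f × e ≼[ 𝒞 ] f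
  ≼-exists tied𝒞 tied𝒟 bound₀ bound e = f , f≢e ∘ sym , e≼f
    where
    module C₀ = Star (star cov𝒞 ps# tied𝒞 e [] bound₀)
    f = proj₁ C₀.extra
    f∈C₀ = proj₁ (proj₂ C₀.extra)
    f≢e = proj₁ (proj₂ (proj₂ C₀.extra))
    f∉core₀ = proj₂ (proj₂ (proj₂ C₀.extra))
    e≼f : e ≼[ 𝒞 ] f
    e≼f {C} 𝒞C e∈C = decidable-stable (f ∈? C) λ f∉C →
      let y , y≢e , y∈C , y∈D = orth 𝒞C D.set∈ e∈C D.e∈set
      in off-C (D.exhausted f∈D f≢e (λ f∈core → off-C₀ f∈core f∈C₀) y∈D y≢e (x∈p∧y∉p⇒x≢y y∈C f∉C)) y∈C
      where
      module D = Star (star cov𝒟 ps# tied𝒟 e (elements C₀.set ++ elements C)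
        (≤-trans (≤-reflexive (cong (λ k → suc k + b) (trans (length-++ (elements C₀.set))
          (cong₂ _+_ (Covering.length-members cov𝒞 C₀.set∈) (Covering.length-members cov𝒞 𝒞C))))) bound))
      off-C₀ : ∀ {x} → x ∈ₗ D.core → x ∉ C₀.set
      off-C₀ x∈core x∈C₀ = D.core#W (x∈core , ∈-++⁺ˡ (∈-elements⁺ x∈C₀))
      off-C : ∀ {x} → x ∈ₗ D.core → x ∉ C
      off-C x∈core x∈C = D.core#W (x∈core , ∈-++⁺ʳ (elements C₀.set) (∈-elements⁺ x∈C))
      -- Otherwise orthogonality gives a common element `x` in the core of `C₀`. Its partner `y` is
      -- in `C₀`, and in `D` because the pairs are tied in `𝒟` as well. Only one of `x` and `y` can
      -- be the extra element of `D`, so its core would meet `C₀`.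
      f∈D : f ∈ D.set
      f∈D = decidable-stable (f ∈? D.set) λ f∉D →
        let x , x≢e , x∈C₀ , x∈D = orth C₀.set∈ D.set∈ C₀.e∈set D.e∈set
            x∈core₀ = C₀.exhausted f∈C₀ f≢e f∉core₀ x∈C₀ x≢e (x∈p∧y∉p⇒x≢y x∈D f∉D)
            y , y∈core₀ , y≢x , x≼y = tied-partner (All-resp-⊆ C₀.pairs⊑ tied𝒟) x∈core₀
            y∈C₀ = All.lookup C₀.core⊆ y∈core₀
        in off-C₀ (D.exhausted x∈D x≢e (λ x∈core → off-C₀ x∈core x∈C₀) (x≼y D.set∈ x∈D)
             (λ y≡e → C₀.e∉core (subst (_∈ₗ C₀.core) y≡e y∈core₀)) y≢x) y∈C₀

orthogonal-sym : ∀ {n} {𝒞 𝒟 : Subset n → Set} → Orthogonal 𝒞 𝒟 → Orthogonal 𝒟 𝒞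
orthogonal-sym orth 𝒟D 𝒞C x∈D x∈C = let y , y≢x , y∈C , y∈D = orth 𝒞C 𝒟D x∈C x∈D in y , y≢x , y∈D , y∈C

record Pairing {n : ℕ} (𝒞 𝒟 : Subset n → Set) : Set where
  field
    σ            : Fin n → Fin n
    σ-involutive : ∀ e → σ (σ e) ≡ e
    σ-fixfree    : ∀ e → e ≢ σ e
    closed𝒞      : ∀ e → e ≼[ 𝒞 ] σ e
    closed𝒟      : ∀ e → e ≼[ 𝒟 ] σ e

-- A common upper bound for the five requirements in `pairing`; the argument of `within` is the
-- slack in each.
pairsNeeded : ℕ → ℕ → ℕ
pairsNeeded s t = suc (2 * s + 2 * s) + (2 * t + t) + s

-- By uniqueness an element tied to e, followed by the element tied to that one, leads back to e.
pairing : ∀ {n a b} {𝒞 𝒟 : Subset n → Set} {ps} → Orthogonal 𝒞 𝒟 → Covering 𝒞 (suc a) → Covering 𝒟 (suc b) →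
  AllPairs (Disjoint on points) ps → All (Tied 𝒟) ps → pairsNeeded (suc a) (suc b) ≤ length ps → Pairing 𝒞 𝒟
pairing {a = a} {b} {𝒞} {𝒟} {ps} orth cov𝒞 cov𝒟 ps# tied𝒟 bound = record
  { σ            = σ
  ; σ-involutive = λ e → decidable-stable (σ (σ e) ≟ e) λ σσe≢e → e≢σe (σ e)
      (unique (e≢σe e) (σσe≢e ∘ sym) (e≼σe e) λ 𝒞C → e≼σe (σ e) 𝒞C ∘ e≼σe e 𝒞C)
  ; σ-fixfree    = e≢σe
  ; closed𝒞      = e≼σe
  -- The ties were found in `𝒞`; `transfer` with the two families exchanged carries them back to
  -- `𝒟`.
  ; closed𝒟      = λ e → transfer (orthogonal-sym orth) cov𝒟 cov𝒞 ps# tied𝒞 bound₁ (e≢σe e) (e≼σe e)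
  }
  where
  open +-*-Solver
  need : Polynomial 2 → Polynomial 2 → Polynomial 2
  need a b = con 1 :+ (con 2 :* s :+ con 2 :* s) :+ (con 2 :* t :+ t) :+ s
    where
    s = con 1 :+ a
    t = con 1 :+ b
  within : ∀ {k} r → k + r ≡ pairsNeeded (suc a) (suc b) → k ≤ length ps
  within r k+r≡ = ≤-trans (m≤m+n _ r) (≤-trans (≤-reflexive k+r≡) bound)
  bound₁ : suc (suc (2 * suc b)) + a ≤ length ps
  bound₁ = within (5 + 4 * a + 1 * b) (solve 2 (λ a b →
    con 2 :+ con 2 :* (con 1 :+ b) :+ a :+ (con 5 :+ con 4 :* a :+ con 1 :* b) := need a b) refl a b)
  bound₂ : suc (suc (2 * suc a)) + b ≤ length ps
  bound₂ = within (5 + 3 * a + 2 * b) (solve 2 (λ a b →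
    con 2 :+ con 2 :* (con 1 :+ a) :+ b :+ (con 5 :+ con 3 :* a :+ con 2 :* b) := need a b) refl a b)
  bound₃ : 1 + a ≤ length ps
  bound₃ = within (8 + 4 * a + 3 * b) (solve 2 (λ a b →
    con 1 :+ a :+ (con 8 :+ con 4 :* a :+ con 3 :* b) := need a b) refl a b)
  bound₄ : suc (2 * suc a + 2 * suc a) + b ≤ length ps
  bound₄ = within (4 + 1 * a + 2 * b) (solve 2 (λ a b →
    con 1 :+ (con 2 :* (con 1 :+ a) :+ con 2 :* (con 1 :+ a)) :+ b :+ (con 4 :+ con 1 :* a :+ con 2 :* b) := need a b) refl a b)
  bound₅ : 3 + a ≤ length ps
  bound₅ = within (6 + 4 * a + 3 * b) (solve 2 (λ a b →
    con 3 :+ a :+ (con 6 :+ con 4 :* a :+ con 3 :* b) := need a b) refl a b)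
  ≼𝒟⇒≼𝒞 : ∀ {e f} → e ≢ f → e ≼[ 𝒟 ] f → e ≼[ 𝒞 ] f
  ≼𝒟⇒≼𝒞 = transfer orth cov𝒞 cov𝒟 ps# tied𝒟 bound₂
  tied𝒞 : All (Tied 𝒞) ps
  tied𝒞 = All.map (λ (y≢z , y≼z , z≼y) → y≢z , (λ {_} → ≼𝒟⇒≼𝒞 y≢z y≼z) , (λ {_} → ≼𝒟⇒≼𝒞 (y≢z ∘ sym) z≼y)) tied𝒟
  exists = ≼-exists orth cov𝒞 cov𝒟 ps# tied𝒞 tied𝒟 bound₃ bound₄
  unique : ∀ {e f g} → e ≢ f → e ≢ g → e ≼[ 𝒞 ] f → e ≼[ 𝒞 ] g → f ≡ g
  unique = ≼-unique cov𝒞 ps# tied𝒞 bound₅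
  σ = λ e → proj₁ (exists e)
  e≢σe : ∀ e → e ≢ σ e
  e≢σe e = proj₁ (proj₂ (exists e))
  e≼σe : ∀ e → e ≼[ 𝒞 ] σ e
  e≼σe e = proj₂ (proj₂ (exists e))

-- Tied pairs from many disjoint members of an orthogonal family

record Rooted {n : ℕ} (ℰ : Subset n → Set) : Set where
  field
    set   : Subset n
    set∈  : ℰ set
    root  : Fin n
    root∈ : root ∈ set

  block : List (Fin n)
  block = elements set

open Rooted

-- The first summand pays for the groups that meet a fixed member of size `2 * t`; the second makes
-- the pigeonhole principle over its `2 * t` elements yield more than `2 * t` groups.
groupsNeeded : ℕ → ℕ
groupsNeeded t = 2 * t + suc (2 * t * (2 * t))

-- In the application `𝒞` holds the cocircuits of size `2 * t` with `t = suc a`, `𝒟` the circuits of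
-- size `2 * s` with `s = suc b`, and `ℰ` the circuits of any size, since those found off a bounded
-- set need not have size `2 * s`.
module _ {n a b : ℕ} {𝒞 𝒟 ℰ : Subset n → Set}
  (orth𝒟 : Orthogonal 𝒞 𝒟) (orthℰ : Orthogonal 𝒞 ℰ)
  (cov𝒞 : Covering 𝒞 (suc a)) (cov𝒟 : Covering 𝒟 (suc b)) where

  private
    Group : Set
    Group = Packing (block {ℰ = ℰ}) a

  -- Orthogonality forbids `C` to meet a block in its root alone, and disjointness keeps the
  -- elements from different blocks distinct.
  two-per-block : ∀ {rs : List (Rooted ℰ)} {C} → AllPairs (Disjoint on block) rs → 𝒞 C → All (λ r → root r ∈ C) rs →
    ∃ λ xs → Unique xs × All (_∈ C) xs × length xs ≡ length rs * 2 × (∀ {x} → x ∈ₗ xs → x ∈ₗ concatMap block rs)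
  two-per-block [] 𝒞C [] = [] , [] , [] , refl , λ ()
  two-per-block {r ∷ rs} (r#rs ∷ rs#) 𝒞C (r∈C ∷ rs∈C) =
    let xs , uxs , xs∈C , ∣xs∣≡ , xs⊆ = two-per-block rs# 𝒞C rs∈C
        y , y≢r , y∈C , y∈r = orthℰ 𝒞C (set∈ r) r∈C (root∈ r)
        off = λ {x} (x∈r : x ∈ set r) (x∈xs : x ∈ₗ xs) →
          let _ , q∈rs , x∈q = find (∈-concatMap⁻ block {xs = rs} (xs⊆ x∈xs)) in All.lookup r#rs q∈rs (∈-elements⁺ x∈r , x∈q)
    in root r ∷ y ∷ xs
     , ∷-unique (λ { (here r≡y) → y≢r (sym r≡y) ; (there r∈xs) → off (root∈ r) r∈xs }) (∷-unique (off y∈r) uxs)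
     , r∈C ∷ y∈C ∷ xs∈C
     , cong (2 +_) ∣xs∣≡
     , λ { (here refl) → ∈-++⁺ˡ (∈-elements⁺ (root∈ r)) ; (there (here refl)) → ∈-++⁺ˡ (∈-elements⁺ y∈r)
         ; (there (there x∈xs)) → ∈-++⁺ʳ (block r) (xs⊆ x∈xs) }

  Link : Rooted ℰ → Group → Fin n → Set
  Link r g z = z ≢ root r × z ∈ set r × ∃ λ C → 𝒞 C × root r ∈ C × z ∈ C ×
    (∀ {x} → x ∈ C → x ≢ root r → x ≢ z → x ∈ₗ support g)

  -- A member of `𝒞` through the `suc a` roots has at least two elements in each of the `suc a`
  -- disjoint blocks. Its size `2 * suc a` leaves no room for more, so apart from `root r` and `z`
  -- it lies in the group.
  link : ∀ r g → Disjoint (block r) (support g) → ∃ (Link r g)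
  link r g r#g
    with Covering.cover cov𝒞 {root r ∷ map root (items g)}
           (∷-unique r∉roots roots-unique) (s≤s (≤-reflexive (trans (length-map root (items g)) (len g))))
    where
    roots-unique : Unique (map root (items g))
    roots-unique = AllPairs-map⁺ (AllPairs.map
      (λ {q} {q′} q#q′ eq → q#q′ (∈-elements⁺ (root∈ q) , ∈-elements⁺ (subst (_∈ set q′) (sym eq) (root∈ q′))))
      (Packing.disjoint g))
    r∉roots : root r ∉ₗ map root (items g)
    r∉roots r∈ = let q , q∈g , r≡q = ∈-map⁻ root r∈ in
      r#g (∈-elements⁺ (root∈ r) , block⊆ block q∈g (∈-elements⁺ (subst (_∈ set q) (sym r≡q) (root∈ q))))
  ... | C , 𝒞C , r∈C ∷ roots∈C =
    let xs , uxs , xs∈C , ∣xs∣≡ , xs⊆g = two-per-block (Packing.disjoint g) 𝒞C (All-map⁻ roots∈C)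
        z , z≢r , z∈C , z∈r = orthℰ 𝒞C (set∈ r) r∈C (root∈ r)
        off = λ {x} (x∈r : x ∈ set r) (x∈xs : x ∈ₗ xs) → r#g (∈-elements⁺ x∈r , xs⊆g x∈xs)
        covered = unique∧∣p∣≤length⇒covers
          (∷-unique (λ { (here r≡z) → z≢r (sym r≡z) ; (there r∈xs) → off (root∈ r) r∈xs }) (∷-unique (off z∈r) uxs))
          (r∈C ∷ z∈C ∷ xs∈C)
          (≤-reflexive (trans (Covering.size cov𝒞 𝒞C) (trans (*-comm 2 (suc a))
            (cong (2 +_) (trans (cong (_* 2) (sym (len g))) (sym ∣xs∣≡))))))
    in z , z≢r , z∈r , C , 𝒞C , r∈C , z∈C , λ x∈C x≢r x≢z → xs⊆g (Any.tail x≢z (Any.tail x≢r (covered x∈C)))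

  -- A member of 𝒟 through root r meeting no block of g has to meet the set linking r to z in z.
  linked-in : ∀ r g {z D} → Link r g z → 𝒟 D → Disjoint (support g) (elements D) → (root r ∈ D → z ∈ D) × (z ∈ D → root r ∈ D)
  linked-in r g {z} {D} (_ , _ , C , 𝒞C , r∈C , z∈C , C⊆) 𝒟D g#D = forth , back
    where
    forth : root r ∈ D → z ∈ D
    forth r∈D = decidable-stable (z ∈? D) λ z∉D →
      let x , x≢r , x∈C , x∈D = orth𝒟 𝒞C 𝒟D r∈C r∈D
      in g#D (C⊆ x∈C x≢r (x∈p∧y∉p⇒x≢y x∈D z∉D) , ∈-elements⁺ x∈D)
    back : z ∈ D → root r ∈ D
    back z∈D = decidable-stable (root r ∈? D) λ r∉D →
      let x , x≢z , x∈C , x∈D = orth𝒟 𝒞C 𝒟D z∈C z∈D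
      in g#D (C⊆ x∈C (x∈p∧y∉p⇒x≢y x∈D r∉D) x≢z , ∈-elements⁺ x∈D)

  -- With k = b + 1, all but 2k groups link the root to elements of one fixed 2k-element set, so some z is linked by
  -- more than 2k groups; every member of 𝒟 misses one of those.
  tie : ∀ r {gs : List Group} → AllPairs (Disjoint on support) gs → All (λ g → Disjoint (block r) (support g)) gs →
    groupsNeeded (suc b) ≤ length gs → ∃ λ z → z ∈ set r × Tied 𝒟 (root r , z)
  tie r {gs} gs# r#gs bound with Covering.cover cov𝒟 {root r ∷ []} ([] ∷ []) (s≤s z≤n)
  ... | D₀ , 𝒟D₀ , r∈D₀ ∷ [] with avoid support (elements D₀) (suc (2 * suc b * (2 * suc b))) gs#
          (≤-trans (≤-reflexive (cong (_+ suc (2 * suc b * (2 * suc b))) (Covering.length-members cov𝒟 𝒟D₀))) bound)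
  ... | gs₁ , gs₁⊑ , ∣gs₁∣≡ , gs₁#D₀ with pigeonhole-⊑ (Link r) (2 * suc b) (elements D₀) chosen
          (≤-reflexive (trans (cong (λ k → suc (k * (2 * suc b))) (Covering.length-members cov𝒟 𝒟D₀)) (sym ∣gs₁∣≡)))
    where
    chosen : All (λ g → ∃ λ z → z ∈ₗ elements D₀ × Link r g z) gs₁
    chosen = All.tabulate λ {g} g∈ →
      let z , rgz = link r g (All.lookup (All-resp-⊆ gs₁⊑ r#gs) g∈)
      in z , ∈-elements⁺ (proj₁ (linked-in r g rgz 𝒟D₀ (All.lookup gs₁#D₀ g∈)) r∈D₀) , rgz
  ... | z , [] , _ , _ , () , _
  ... | z , gs₂@(_ ∷ _) , _ , gs₂⊑ , 2t<∣gs₂∣ , links@((z≢r , z∈r , _) ∷ _) =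
    z , z∈r , z≢r ∘ sym , (λ 𝒟D → proj₁ (iff 𝒟D)) , (λ 𝒟D → proj₂ (iff 𝒟D))
    where
    iff : ∀ {D} → 𝒟 D → (root r ∈ D → z ∈ D) × (z ∈ D → root r ∈ D)
    iff {D} 𝒟D with avoid support (elements D) 1 (AllPairs-resp-⊑ (⊑-trans gs₂⊑ gs₁⊑) gs#)
      (≤-trans (≤-reflexive (trans (+-comm _ 1) (cong suc (Covering.length-members cov𝒟 𝒟D)))) 2t<∣gs₂∣)
    ... | g ∷ [] , g⊑ , _ , g#D ∷ [] with All-resp-⊆ g⊑ links
    ... | rgz ∷ [] = linked-in r g rgz 𝒟D g#D

  -- All roots share the same groups. The last component keeps each pair inside the block it came
  -- from, which carries disjointness through the induction.
  tied-pairs : ∀ {rs} {gs : List Group} → AllPairs (Disjoint on block) rs →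
    All (λ r → All (λ g → Disjoint (block r) (support g)) gs) rs →
    AllPairs (Disjoint on support) gs → groupsNeeded (suc b) ≤ length gs →
    ∃ λ ps → length ps ≡ length rs × AllPairs (Disjoint on points) ps × All (Tied 𝒟) ps ×
      All (λ p → ∃ λ r → r ∈ₗ rs × (∀ {x} → x ∈ₗ points p → x ∈ₗ block r)) ps
  tied-pairs [] [] _ _ = [] , refl , [] , [] , []
  tied-pairs {r ∷ rs} (r#rs ∷ rs#) (r#gs ∷ rs#gs) gs# bound
    with tied-pairs rs# rs#gs gs# bound | tie r gs# r#gs bound
  ... | ps , ∣ps∣≡ , ps# , tied , ps⊆ | z , z∈r , tied-z =
    (root r , z) ∷ ps , cong suc ∣ps∣≡
    , All.tabulate (λ p∈ps (x∈rz , x∈p) →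
        let q , q∈rs , p⊆q = All.lookup ps⊆ p∈ps in All.lookup r#rs q∈rs (rz⊆r x∈rz , p⊆q x∈p)) ∷ ps#
    , tied-z ∷ tied
    , (r , here refl , rz⊆r) ∷ All.map (λ (q , q∈rs , p⊆q) → q , there q∈rs , λ {_} → p⊆q) ps⊆
    where
    rz⊆r : ∀ {x} → x ∈ₗ points (root r , z) → x ∈ₗ block r
    rz⊆r (here refl) = ∈-elements⁺ (root∈ r)
    rz⊆r (there (here refl)) = ∈-elements⁺ z∈r

-- Spikes from pairings

lookup-injective : ∀ {A : Set} {xs : List A} → Unique xs → ∀ {i j} → lookup xs i ≡ lookup xs j → i ≡ j
lookup-injective (_ ∷ _) {zero} {zero} _ = refl
lookup-injective {xs = _ ∷ xs} (x≢xs ∷ _) {zero} {suc j} eq = contradiction eq (All.lookup x≢xs (∈-lookup j))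
lookup-injective {xs = _ ∷ xs} (x≢xs ∷ _) {suc i} {zero} eq = contradiction (sym eq) (All.lookup x≢xs (∈-lookup i))
lookup-injective (_ ∷ uxs) {suc i} {suc j} eq = cong suc (lookup-injective uxs eq)

module _ {n m : ℕ} (p : Fin n → Fin m) {I : Subset m} where

  ∈-blocks⁺ : ∀ {x} → p x ∈ I → x ∈ blocks p I
  ∈-blocks⁺ {x} px∈I = lookup⇒[]= x _ (trans (lookup∘tabulate _ x) ([]=⇒lookup px∈I))

  ∈-blocks⁻ : ∀ {x} → x ∈ blocks p I → p x ∈ I
  ∈-blocks⁻ {x} x∈ = lookup⇒[]= (p x) I (trans (sym (lookup∘tabulate _ x)) ([]=⇒lookup x∈))

-- Orbits of a fixed-point-free involution

module Orbits {n : ℕ} (σ : Fin n → Fin n) (σ-involutive : ∀ e → σ (σ e) ≡ e) (σ-fixfree : ∀ e → e ≢ σ e) where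

  reps : List (Fin n)
  reps = filter (λ e → e <? σ e) (allFin n)

  m : ℕ
  m = length reps

  reps-unique : Unique reps
  reps-unique = filter⁺ (λ e → e <? σ e) (allFin⁺ n)

  rep-or-σ : ∀ e → e ∈ₗ reps ⊎ σ e ∈ₗ reps
  rep-or-σ e with <-cmp e (σ e)
  ... | tri< e<σe _ _ = inj₁ (∈-filter⁺ (λ e → e <? σ e) (∈-allFin e) e<σe)
  ... | tri≈ _ e≡σe _ = contradiction e≡σe (σ-fixfree e)
  ... | tri> _ _ σe<e = inj₂ (∈-filter⁺ (λ e → e <? σ e) (∈-allFin (σ e)) (subst (σ e <ᶠ_) (sym (σ-involutive e)) σe<e))

  σ-rep∉reps : ∀ {e} → e ∈ₗ reps → σ e ∉ₗ reps
  σ-rep∉reps {e} e∈ σe∈ = <-asym (rep< e∈) (subst (σ e <ᶠ_) (σ-involutive e) (rep< σe∈))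
    where
    rep< : ∀ {e} → e ∈ₗ reps → e <ᶠ σ e
    rep< e∈ = proj₂ (∈-filter⁻ (λ e → e <? σ e) {xs = allFin n} e∈)

  rep : Fin m → Fin n
  rep = lookup reps

  orbit : Fin n → Fin m
  orbit e = [ Any.index , Any.index ]′ (rep-or-σ e)

  rep-orbit : ∀ e → e ≡ rep (orbit e) ⊎ e ≡ σ (rep (orbit e))
  rep-orbit e with rep-or-σ e
  ... | inj₁ e∈ = inj₁ (lookup-index e∈)
  ... | inj₂ σe∈ = inj₂ (trans (sym (σ-involutive e)) (cong σ (lookup-index σe∈)))

  orbit-rep : ∀ i → orbit (rep i) ≡ i
  orbit-rep i with rep-orbit (rep i)
  ... | inj₁ eq = sym (lookup-injective reps-unique eq)
  ... | inj₂ eq = contradiction (subst (_∈ₗ reps) eq (∈-lookup i)) (σ-rep∉reps (∈-lookup _))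

  orbit-σrep : ∀ i → orbit (σ (rep i)) ≡ i
  orbit-σrep i with rep-orbit (σ (rep i))
  ... | inj₁ eq = contradiction (subst (_∈ₗ reps) (sym eq) (∈-lookup _)) (σ-rep∉reps (∈-lookup i))
  ... | inj₂ eq = sym (lookup-injective reps-unique (trans (sym (σ-involutive _)) (trans (cong σ eq) (σ-involutive _))))

  transversal : Subset m → List (Fin n)
  transversal I = map rep (elements I)

  orbits : Subset m → List (Fin n)
  orbits I = transversal I ++ map σ (transversal I)

  length-transversal : ∀ I → length (transversal I) ≡ ∣ I ∣
  length-transversal I = trans (length-map rep (elements I)) (length-elements I)

  length-orbits : ∀ I → length (orbits I) ≡ 2 * ∣ I ∣
  length-orbits I = trans (length-++ (transversal I)) (cong₂ _+_ (length-transversal I)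
    (trans (length-map σ (transversal I)) (trans (length-transversal I) (sym (+-identityʳ ∣ I ∣)))))

  transversal-unique : ∀ I → Unique (transversal I)
  transversal-unique I = map⁺ (lookup-injective reps-unique) elements-unique

  orbits-unique : ∀ I → Unique (orbits I)
  orbits-unique I = ++⁺ (transversal-unique I)
    (map⁺ (λ {x} {y} eq → trans (sym (σ-involutive x)) (trans (cong σ eq) (σ-involutive y))) (transversal-unique I))
    λ (x∈ , x∈σ) → let y , y∈ , x≡σy = ∈-map⁻ σ x∈σ in σ-rep∉reps (⊆reps y∈) (subst (_∈ₗ reps) x≡σy (⊆reps x∈))
    where
    ⊆reps : ∀ {x} → x ∈ₗ transversal I → x ∈ₗ reps
    ⊆reps x∈ = let i , _ , x≡ = ∈-map⁻ rep x∈ in subst (_∈ₗ reps) (sym x≡) (∈-lookup i)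

  ∈-orbits⁺ : ∀ {I x} → orbit x ∈ I → x ∈ₗ orbits I
  ∈-orbits⁺ {I} {x} ox∈I with rep-orbit x
  ... | inj₁ eq = subst (_∈ₗ orbits I) (sym eq) (∈-++⁺ˡ (∈-map⁺ rep (∈-elements⁺ ox∈I)))
  ... | inj₂ eq = subst (_∈ₗ orbits I) (sym eq) (∈-++⁺ʳ (transversal I) (∈-map⁺ σ (∈-map⁺ rep (∈-elements⁺ ox∈I))))

  ∈-orbits⁻ : ∀ {I x} → x ∈ₗ orbits I → orbit x ∈ I
  ∈-orbits⁻ {I} x∈ with ∈-++⁻ (transversal I) x∈
  ... | inj₁ x∈T = let i , i∈I , x≡ = ∈-map⁻ rep x∈T
                   in subst (_∈ I) (sym (trans (cong orbit x≡) (orbit-rep i))) (∈-elements⁻ i∈I)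
  ... | inj₂ x∈σT with ∈-map⁻ σ x∈σT
  ... | y , y∈T , x≡σy = let i , i∈I , y≡ = ∈-map⁻ rep y∈T
                         in subst (_∈ I) (sym (trans (cong orbit (trans x≡σy (cong σ y≡))) (orbit-σrep i))) (∈-elements⁻ i∈I)

  ∣blocks∣ : ∀ I → ∣ blocks orbit I ∣ ≡ 2 * ∣ I ∣
  ∣blocks∣ I = trans (≤-antisym
    (∣p∣≤length (orbits I) (∈-orbits⁺ ∘ ∈-blocks⁻ orbit {I}))
    (length≤∣p∣ (orbits-unique I) (All.tabulate (∈-blocks⁺ orbit ∘ ∈-orbits⁻)))) (length-orbits I)

  n≤2m : n ≤ 2 * m
  n≤2m = begin
    n                     ≡⟨ sym (∣⊤∣≡n n) ⟩
    ∣ ⊤ {n} ∣             ≤⟨ ∣p∣≤length {p = ⊤} (orbits ⊤) (λ _ → ∈-orbits⁺ ∈⊤) ⟩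
    length (orbits ⊤)     ≡⟨ length-orbits ⊤ ⟩
    2 * ∣ ⊤ {m} ∣         ≡⟨ cong (2 *_) (∣⊤∣≡n m) ⟩
    2 * m                 ∎
    where open ≤-Reasoning

  -- A member through one representative of each chosen orbit contains the partners too. These are
  -- already `2 * k` elements, so it is exactly the union of the orbits.
  closed-member : ∀ {k} {𝒞 : Subset n → Set} → Covering 𝒞 k → (∀ e → e ≼[ 𝒞 ] σ e) →
    ∀ I → ∣ I ∣ ≡ k → 𝒞 (blocks orbit I)
  closed-member {k} {𝒞} cov closed I ∣I∣≡k
    with Covering.cover cov (transversal-unique I) (≤-reflexive (trans (length-transversal I) ∣I∣≡k))
  ... | C , 𝒞C , T∈C = subst 𝒞 (⊆-antisym
      (∈-blocks⁺ orbit ∘ ∈-orbits⁻ ∘ unique∧∣p∣≤length⇒covers (orbits-unique I) orbits∈C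
        (≤-reflexive (trans (Covering.size cov 𝒞C) (sym (trans (length-orbits I) (cong (2 *_) ∣I∣≡k))))))
      (All.lookup orbits∈C ∘ ∈-orbits⁺ ∘ ∈-blocks⁻ orbit)) 𝒞C
    where
    orbits∈C : All (_∈ C) (orbits I)
    orbits∈C = All-++⁺ T∈C (All-map⁺ (All.map (closed _ 𝒞C) T∈C))

pairing⇒spike : ∀ {n s t} (M : Matroid n) →
  Covering (Sized (IsCircuit M) s) s → Covering (Sized (IsCocircuit M) t) t →
  Pairing (Sized (IsCocircuit M) t) (Sized (IsCircuit M) s) → 2 * (s ⊔ t) ≤ n → IsSpike M s t
pairing⇒spike M covC covD P bound =
  m , *-cancelˡ-≤ 2 (≤-trans bound n≤2m) , orbit
  , (λ i → trans (∣blocks∣ ⁅ i ⁆) (cong (2 *_) (∣⁅x⁆∣≡1 i)))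
  , (λ I ∣I∣≡s → proj₁ (closed-member covC closed𝒟 I ∣I∣≡s))
  , (λ J ∣J∣≡t → proj₁ (closed-member covD closed𝒞 J ∣J∣≡t))
  where
  open Pairing P
  open Orbits σ σ-involutive σ-fixfree

-- The explicit bound and the assembly

avoidSize : ℕ → ℕ → ℕ
avoidSize s w = w + suc w * (2 * s)

-- In `circuit-avoiding` the same number bounds the circuit and is required of `n`, so `avoidSize`
-- takes both roles.
rooted-circuits-available : ∀ {n a} (M : Matroid n) → Covering (Sized (IsCircuit M) (suc a)) (suc a) →
  Available (block {ℰ = IsCircuit M}) (avoidSize (suc a)) (avoidSize (suc a))
rooted-circuits-available {a = a} M cov {w} W ∣W∣≤w need =
  let ∣W∣≤ = ≤-trans (∣fromList∣≤length W) ∣W∣≤w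
      size≤ = +-mono-≤ ∣W∣≤ (*-monoˡ-≤ (2 * suc a) (s≤s ∣W∣≤))
      C , cC , C#W , ∣C∣≤ = circuit-avoiding M cov (fromList W) (≤-trans size≤ need)
      x , x∈C = circuit-nonempty M cC
  in record { set = C ; set∈ = cC ; root = x ; root∈ = x∈C }
     , (λ (v∈C , v∈W) → C#W (∈-elements⁻ v∈C) (∈-fromList⁺ v∈W))
     , ≤-trans (≤-reflexive (length-elements C)) (≤-trans ∣C∣≤ size≤)

-- Groups have `pred t` circuits because the circuit of the root is the remaining one. They are
-- packed first, and the rooted circuits then avoid all of them. The summand `2 * (s ⊔ t)` ensures
-- at least `s ⊔ t` pairs in the spike.
module Bounds (s t : ℕ) where
  groupSize groupNeed : ℕ → ℕ
  groupSize = packSize (avoidSize s) (pred t)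
  groupNeed = packNeed (avoidSize s) (avoidSize s) (pred t)

  groupsSize groupsTotal pairsTotal : ℕ
  groupsSize = packSize groupSize (groupsNeeded s) 0
  groupsTotal = packNeed groupSize groupNeed (groupsNeeded s) 0
  pairsTotal = packNeed (avoidSize s) (avoidSize s) (pairsNeeded t s) groupsSize

  total : ℕ
  total = groupsTotal + (pairsTotal + 2 * (s ⊔ t))

many-elements⇒spike : ∀ s t → 1 ≤ s → 1 ≤ t → ∀ n (M : Matroid n) →
  HasProperty M s (2 * s) t (2 * t) → Bounds.total s t ≤ n → IsSpike M s t
many-elements⇒spike (suc a) (suc b) _ _ n M (_ , _ , circ , cocirc) total≤n =
  let gs , _ , ∣gs∣≤ = pack support (pack block available b) (groupsNeeded (suc a)) {0} [] z≤n
        (≤-trans (m≤m+n groupsTotal _) total≤n)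
      rs , rs#gs , _ = pack block available (pairsNeeded (suc b) (suc a)) (support gs) ∣gs∣≤
        (≤-trans (m≤m+n pairsTotal _) (≤-trans (m≤n+m _ groupsTotal) total≤n))
      ps , ∣ps∣≡ , ps# , tied , _ = tied-pairs orth𝒟 orthℰ covD covC (Packing.disjoint rs)
        (All.tabulate λ r∈rs → All.tabulate λ g∈gs (v∈r , v∈g) → rs#gs (block⊆ block r∈rs v∈r , block⊆ support g∈gs v∈g))
        (Packing.disjoint gs) (≤-reflexive (sym (len gs)))
  in pairing⇒spike M covC covD (pairing orth𝒟 covD covC ps# tied (≤-reflexive (sym (trans ∣ps∣≡ (len rs))))) 2[s⊔t]≤n
  where
  open Bounds (suc a) (suc b)
  2[s⊔t]≤n : 2 * (suc a ⊔ suc b) ≤ n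
  2[s⊔t]≤n = ≤-trans (m≤n+m _ pairsTotal) (≤-trans (m≤n+m _ groupsTotal) total≤n)
  s⊔t≤n : suc a ⊔ suc b ≤ n
  s⊔t≤n = ≤-trans (m≤m+n _ _) 2[s⊔t]≤n
  covC : Covering (Sized (IsCircuit M) (suc a)) (suc a)
  covC = covering (≤-trans (m≤m⊔n (suc a) (suc b)) s⊔t≤n) circ
  covD : Covering (Sized (IsCocircuit M) (suc b)) (suc b)
  covD = covering (≤-trans (m≤n⊔m (suc a) (suc b)) s⊔t≤n) cocirc
  orthℰ : Orthogonal (Sized (IsCocircuit M) (suc b)) (IsCircuit M)
  orthℰ (cD , _) cC x∈D x∈C = orthogonal-sym (circuit-cocircuit-orthogonal M) cD cC x∈D x∈C
  orth𝒟 : Orthogonal (Sized (IsCocircuit M) (suc b)) (Sized (IsCircuit M) (suc a))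
  orth𝒟 cD (cC , _) = orthℰ cD cC
  available : Available (block {ℰ = IsCircuit M}) (avoidSize (suc a)) (avoidSize (suc a))
  available = rooted-circuits-available M covC

theorem1p1 : Σ (ℕ → ℕ → ℕ) λ f →
    ∀ (s t : ℕ) → 1 ≤ s → 1 ≤ t →
    ∀ (n : ℕ) (M : Matroid n) →
    HasProperty M s (2 * s) t (2 * t) → f s t ≤ n → IsSpike M s t
theorem1p1 = Bounds.total , many-elements⇒spike
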